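{- Let $\mathcal{G}=(V,E,\lambda)$ be a happy compressed temporal graph that is temporally connected. If $e_2$ is a convergent edge and $e_1$ is a divergent edge such that $e_2\leadsto e_1$, then both $e_1$ and $e_2$ are pivot edges of $\mathcal{G}$. Furthermore, if $\mathcal{G}$ is minimal, this implies $e_1=e_2$.
   Context: A happy temporal graph is a triple $\mathcal{G}=(V,E,\lambda)$ where $(V,E)$ is a finite simple undirected graph (the footprint) and $\lambda:E\to\{1,2,3,\dots\}$ assigns a single time label to each edge, such that two distinct edges sharing an endpoint have different labels. It is compressed if for every edge $e$ with $\lambda(e)>1$ there is an edge $e'$ adjacent to $e$ with $\lambda(e')=\lambda(e)-1$. A temporal walk is a walk in the footprint along which edge labels are strictly increasing (so no edge is repeated); the empty walk is allowed. For vertices $u,v$ and edges $e,e'$: $u\leadsto v$ means there is a temporal walk from $u$ to $v$; $v\leadsto e$ means some temporal walk starts at $v$ and traverses $e$; $e\leadsto v$ means some temporal walk traverses $e$ and ends at $v$; $e\leadsto e'$ means some temporal walk traverses $e$ and $e'$ in this order, not necessarily consecutively (with $e\leadsto e$ always). Edges may be traversed in either direction. $\mathcal{G}$ is temporally connected if $u\leadsto v$ for all $u,v\in V$. The reachability graph $\mathcal{R}(\mathcal{G})$ is the directed graph on $V$ with arcs $(u,v)$ whenever $u\leadsto v$; $\mathcal{G}$ is minimal if $\mathcal{R}(\mathcal{G}\setminus\{e\})\ne\mathcal{R}(\mathcal{G})$ for every $e\in E$ (deleting $e$, keeping all vertices and the other labelled edges). An edge $e$ is a source edge if $e\leadsto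 v$ for all $v\in V$, a sink edge if $v\leadsto e$ for all $v\in V$, and a pivot edge if it is both. A divergent edge is a source edge $e$ such that there is no other source edge $e'\neq e$ with $e\leadsto e'$. A div-sink edge is a sink edge $e$ such that $d\leadsto e$ for every divergent edge $d$. A convergent edge is a div-sink edge $e$ such that there is no other div-sink edge $e'\ne e$ with $e'\leadsto e$. -}

module Defs where

open import Data.Bool using (Bool; T; _∧_; not)
open import Data.Bool.Properties using (T-∧)
open import Data.Fin as Fin using (Fin)
open import Data.Fin.Properties using (_≟_)
open import Data.List using (List; []; _∷_; map)
open import Data.List.Membership.Propositional using (_∈_)
open import Data.List.Relation.Binary.Sublist.Propositional using (_⊆_)
open import Data.List.Relation.Unary.Linked using (Linked)
open import Data.Nat using (ℕ; _≤_; _<_; _∸_)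
open import Data.Product using (Σ-syntax; ∃-syntax; _×_; _,_; proj₁)
open import Data.Sum using (_⊎_)
open import Function.Bundles using (Equivalence)
open import Level using (0ℓ)
open import Relation.Binary.Core using (Rel; _⇔_)
open import Relation.Binary.PropositionalEquality using (_≡_; _≢_)
open import Relation.Nullary using (¬_; does; _×-dec_)

-- A two-element subset {lo , hi} of Fin n, listed in increasing order so that
-- each subset has a unique representative; the order proof is irrelevant.
record Pair (n : ℕ) : Set where
  constructor pair
  field
    lo hi  : Fin n
    .lo<hi : lo Fin.< hi

open Pair public

samePair : ∀ {n} → Pair n → Pair n → Bool
samePair p q = does ((lo p ≟ lo q) ×-dec (hi p ≟ hi q))

-- A finite simple undirected graph on Fin n is a set of two-element subsets,
-- given here by its characteristic function.
EdgeSet : ℕ → Set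
EdgeSet n = Pair n → Bool

-- Membership is irrelevant, so two edges are equal (_≡_) as soon as they have
-- the same endpoints.
record Edge {n : ℕ} (E : EdgeSet n) : Set where
  constructor edge
  field
    ends    : Pair n
    .member : T (E ends)

open Edge public

record TemporalGraph : Set where
  field
    order     : ℕ
    edgeSet   : EdgeSet order
    label     : Edge edgeSet → ℕ
    label-pos : ∀ e → 1 ≤ label e

  V : Set
  V = Fin order

  E : Set
  E = Edge edgeSet

module _ (G : TemporalGraph) where
  open TemporalGraph G

  _endpointOf_ : V → E → Set
  v endpointOf e = v ≡ lo (ends e) ⊎ v ≡ hi (ends e)

  Adjacent : E → E → Set
  Adjacent e e′ = e ≢ e′ × ∃[ v ] (v endpointOf e × v endpointOf e′)

  Happy : Set
  Happy = ∀ e e′ → Adjacent e e′ → label e ≢ label e′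

  Compressed : Set
  Compressed = ∀ e → 1 < label e → ∃[ e′ ] (Adjacent e e′ × label e′ ≡ label e ∸ 1)

  Joins : E → V → V → Set
  Joins e u v = (u ≡ lo (ends e) × v ≡ hi (ends e))
              ⊎ (u ≡ hi (ends e) × v ≡ lo (ends e))

  data Walk : V → V → Set where
    []   : ∀ {v} → Walk v v
    step : ∀ {u v w} (e : E) → Joins e u v → Walk v w → Walk u w

  edges : ∀ {u v} → Walk u v → List E
  edges []           = []
  edges (step e _ w) = e ∷ edges w

  -- `Linked _<_` compares consecutive labels.
  Temporal : ∀ {u v} → Walk u v → Set
  Temporal w = Linked _<_ (map label (edges w))

  TemporalWalk : V → V → Set
  TemporalWalk u v = Σ[ w ∈ Walk u v ] Temporal w

  trace : ∀ {u v} → TemporalWalk u v → List E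
  trace (w , _) = edges w

  -- The arc relation of the reachability graph.
  Reach : Rel V 0ℓ
  Reach u v = TemporalWalk u v

  VertexToEdge : V → E → Set
  VertexToEdge v e = ∃[ u ] Σ[ w ∈ TemporalWalk v u ] e ∈ trace w

  EdgeToVertex : E → V → Set
  EdgeToVertex e v = ∃[ u ] Σ[ w ∈ TemporalWalk u v ] e ∈ trace w

  -- `e ∷ e′ ∷ [] ⊆ trace w` is the order-preserving sublist relation: e occurs
  -- before e′ in w, not necessarily consecutively.
  EdgeToEdge : E → E → Set
  EdgeToEdge e e′ =
    e ≡ e′ ⊎ ∃[ u ] ∃[ v ] Σ[ w ∈ TemporalWalk u v ] (e ∷ e′ ∷ [] ⊆ trace w)

  TemporallyConnected : Set
  TemporallyConnected = ∀ u v → Reach u v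

  SourceEdge : E → Set
  SourceEdge e = ∀ v → EdgeToVertex e v

  SinkEdge : E → Set
  SinkEdge e = ∀ v → VertexToEdge v e

  PivotEdge : E → Set
  PivotEdge e = SourceEdge e × SinkEdge e

  DivergentEdge : E → Set
  DivergentEdge e =
    SourceEdge e × ¬ (∃[ e′ ] (SourceEdge e′ × e′ ≢ e × EdgeToEdge e e′))

  DivSinkEdge : E → Set
  DivSinkEdge e = SinkEdge e × (∀ d → DivergentEdge d → EdgeToEdge d e)

  ConvergentEdge : E → Set
  ConvergentEdge e =
    DivSinkEdge e × ¬ (∃[ e′ ] (DivSinkEdge e′ × e′ ≢ e × EdgeToEdge e′ e))

  deletedEdgeSet : E → EdgeSet order
  deletedEdgeSet e p = edgeSet p ∧ not (samePair p (ends e))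

  keep : ∀ e → Edge (deletedEdgeSet e) → E
  keep e (edge p m) = edge p (proj₁ (Equivalence.to T-∧ m))

  delete : E → TemporalGraph
  delete e = record
    { order     = order
    ; edgeSet   = deletedEdgeSet e
    ; label     = λ f → label (keep e f)
    ; label-pos = λ f → label-pos (keep e f)
    }

-- Two digraphs on the same vertex set are equal when their arc relations
-- coincide, so inequality is the negation of mutual inclusion.
Minimal : TemporalGraph → Set
Minimal G = ∀ e → ¬ (Reach (delete G e) ⇔ Reach G)

{-# OPTIONS --safe #-}
-- Labels strictly increase along a temporal walk, so _⇝_ on edges is
-- antisymmetric.  A convergent edge is a div-sink edge, hence e₁ ⇝ e₂ for the
-- divergent edge e₁; together with e₂ ⇝ e₁ this forces e₁ = e₂, an edge that is
-- both source and sink.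
module Submission where

open import Data.List using (List; []; _∷_)
open import Data.List.Relation.Binary.Sublist.Propositional using (_⊆_; []; _∷_; _∷ʳ_)
open import Data.List.Relation.Binary.Sublist.Propositional.Properties using (map⁺; All-resp-⊆)
open import Data.List.Relation.Unary.All using ([]; _∷_)
open import Data.List.Relation.Unary.AllPairs using (AllPairs; []; _∷_)
open import Data.List.Relation.Unary.Linked.Properties using (Linked⇒AllPairs)
open import Data.Nat using (_<_)
open import Data.Nat.Properties using (<-trans; <-asym)
open import Data.Product using (_×_; _,_)
open import Data.Sum using (_⊎_; inj₁; inj₂)
open import Relation.Binary.Core using (Rel)
open import Relation.Binary.PropositionalEquality using (_≡_; refl; subst; sym)
open import Relation.Nullary using (contradiction)
open import Defs

-- Dropping entries creates new neighbours, so `Linked` need not pass to sublists; `AllPairs` does,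
-- which suits edges that are not consecutive in a walk.
AllPairs-antimono : ∀ {a ℓ} {A : Set a} {R : Rel A ℓ} {xs ys : List A} →
  xs ⊆ ys → AllPairs R ys → AllPairs R xs
AllPairs-antimono []             []         = []
AllPairs-antimono (_ ∷ʳ xs⊆ys)   (_ ∷ rys)  = AllPairs-antimono xs⊆ys rys
AllPairs-antimono (refl ∷ xs⊆ys) (ry ∷ rys) = All-resp-⊆ xs⊆ys ry ∷ AllPairs-antimono xs⊆ys rys

module _ (G : TemporalGraph) where
  open TemporalGraph G

  EdgeToEdge⇒≡⊎< : ∀ {e e′} → EdgeToEdge G e e′ → e ≡ e′ ⊎ label e < label e′
  EdgeToEdge⇒≡⊎< (inj₁ e≡e′) = inj₁ e≡e′
  EdgeToEdge⇒≡⊎< (inj₂ (_ , _ , (_ , increasing) , e,e′⊆w))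
    -- Transitivity of `_<_` extends the comparison of consecutive labels to all pairs, and
    -- `map⁺ label` turns the two-edge sublist into one of labels.
    with AllPairs-antimono (map⁺ label e,e′⊆w) (Linked⇒AllPairs <-trans increasing)
  ... | (e<e′ ∷ []) ∷ _ = inj₂ e<e′

  EdgeToEdge-antisym : ∀ {e e′} → EdgeToEdge G e e′ → EdgeToEdge G e′ e → e ≡ e′
  EdgeToEdge-antisym e⇝e′ e′⇝e with EdgeToEdge⇒≡⊎< e⇝e′ | EdgeToEdge⇒≡⊎< e′⇝e
  ... | inj₁ e≡e′ | _         = e≡e′
  ... | inj₂ _    | inj₁ e′≡e = sym e′≡e
  ... | inj₂ e<e′ | inj₂ e′<e = contradiction e′<e (<-asym e<e′)

lemma3p34 : (G : TemporalGraph) → Happy G → Compressed G → TemporallyConnected G →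
    (e₁ e₂ : TemporalGraph.E G) →
    ConvergentEdge G e₂ → DivergentEdge G e₁ → EdgeToEdge G e₂ e₁ →
    (PivotEdge G e₁ × PivotEdge G e₂) × (Minimal G → e₁ ≡ e₂)
lemma3p34 G _ _ _ e₁ e₂ ((sink , divergent⇝e₂) , _) divergent@(source , _) e₂⇝e₁ =
  -- Divergence gives the source half for `e₁`, convergence the sink half for `e₂`; the equality
  -- transports each to the other edge.
  ( (source , subst (SinkEdge G) (sym e₁≡e₂) sink)
  , (subst (SourceEdge G) e₁≡e₂ source , sink)
  ) , λ _ → e₁≡e₂
  where
  e₁≡e₂ : e₁ ≡ e₂
  e₁≡e₂ = EdgeToEdge-antisym G (divergent⇝e₂ e₁ divergent) e₂⇝e₁
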